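{- Every $\mathbf{A}\in\mathsf{BI}(\mathrm{cl},\mathrm{ca}_\vee)$ satisfies $a\wedge\neg a=0$ for all $a\in A$.
   Context: A BALFI (Boolean algebra with LFI operators) is an algebra $\mathbf{B}=\langle B,\wedge,\vee,\to,\neg,\circ,0,1\rangle$, with unary operations $\neg,\circ$, such that $\langle B,\wedge,\vee,\to,0,1\rangle$ is a Boolean algebra and, for every $a\in B$, $a\vee\neg a=1$ and $a\wedge\neg a\wedge\circ a=0$ (in general $\neg$ is not the Boolean complement). $\mathsf{BI}(\mathrm{cl},\mathrm{ca}_\vee)$ is the class of all BALFIs satisfying, for all elements $a,b$: - $(\mathrm{cl})$: $\circ a=\neg(a\wedge\neg a)$; - $(\mathrm{ca}_\vee)$: $(\circ a\wedge\circ b)\wedge\circ(a\vee b)=\circ a\wedge\circ b$. -}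

module Defs where

open import Level using (suc; _⊔_)
open import Algebra.Core using (Op₁; Op₂)
open import Algebra.Definitions using (Congruent₁)
open import Algebra.Lattice.Structures using (IsBooleanAlgebra)
open import Relation.Binary.Core using (Rel)

-- Boolean algebras in the signature ⟨∧, ∨, ⇒, 0, 1⟩: the Boolean complement
-- is not an operation of the signature but the term a ⇒ 0.  Together with the
-- second field, ⇒ is then the Boolean implication.

record IsImplicativeBooleanAlgebra {c ℓ} {A : Set c} (_≈_ : Rel A ℓ)
         (_∧_ _∨_ _⇒_ : Op₂ A) (⊥ ⊤ : A) : Set (c ⊔ ℓ) where
  field
    isBooleanAlgebra : IsBooleanAlgebra _≈_ _∨_ _∧_ (λ a → a ⇒ ⊥) ⊤ ⊥
    ⇒-def            : ∀ a b → (a ⇒ b) ≈ ((a ⇒ ⊥) ∨ b)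

  open IsBooleanAlgebra isBooleanAlgebra public

-- ¬_ is the paraconsistent negation, not the Boolean complement.  As _≈_ is
-- the equality of the algebra, all operations must respect it; for ∧, ∨ and ⇒
-- this follows from the Boolean algebra structure.

record BALFI c ℓ : Set (suc (c ⊔ ℓ)) where
  infix  8 ¬_ ∘_
  infixr 7 _∧_
  infixr 6 _∨_
  infixr 5 _⇒_
  infix  4 _≈_
  field
    Carrier : Set c
    _≈_     : Rel Carrier ℓ
    _∧_     : Op₂ Carrier
    _∨_     : Op₂ Carrier
    _⇒_     : Op₂ Carrier
    ¬_      : Op₁ Carrier
    ∘_      : Op₁ Carrier
    ⊥       : Carrier
    ⊤       : Carrier
    isImplicativeBooleanAlgebra :
      IsImplicativeBooleanAlgebra _≈_ _∧_ _∨_ _⇒_ ⊥ ⊤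
    ¬-cong           : Congruent₁ _≈_ ¬_
    ∘-cong           : Congruent₁ _≈_ ∘_
    excluded-middle  : ∀ a → a ∨ ¬ a ≈ ⊤
    gentle-explosion : ∀ a → a ∧ ¬ a ∧ ∘ a ≈ ⊥

  -- The library's ¬-cong is the congruence of the Boolean complement.
  open IsImplicativeBooleanAlgebra isImplicativeBooleanAlgebra public
    renaming (¬-cong to complement-cong)

record BI[cl,ca∨] {c ℓ} (𝐁 : BALFI c ℓ) : Set (c ⊔ ℓ) where
  open BALFI 𝐁
  field
    cl  : ∀ a → ∘ a ≈ ¬ (a ∧ ¬ a)
    ca∨ : ∀ a b → (∘ a ∧ ∘ b) ∧ ∘ (a ∨ b) ≈ ∘ a ∧ ∘ b

{-# OPTIONS --safe #-}

-- Let x = a ∧ ¬ a.  By cl, ∘ a = ¬ x is the Boolean complement of x, and hence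
-- ∘ x = ¬ ⊥ = ⊤.  Put y = a ∧ ∘ a, so that a = x ∨ y; then ca∨ gives ∘ y ≤ ∘ a.
-- So x is disjoint from ∘ y, and it is disjoint from y ∧ ¬ y because y ≤ ∘ a.
-- These two elements join to ⊤, hence x = ⊥.

module Submission where

open import Algebra.Lattice.Bundles using (BooleanAlgebra)
import Algebra.Lattice.Properties.BooleanAlgebra as BooleanAlgebraProperties
import Relation.Binary.Reasoning.Setoid as SetoidReasoning
open import Defs

module BALFIProperties {c ℓ} (𝐁 : BALFI c ℓ) where
  open BALFI 𝐁

  booleanAlgebra : BooleanAlgebra c ℓ
  booleanAlgebra = record { isBooleanAlgebra = isBooleanAlgebra }

  open BooleanAlgebra booleanAlgebra public using (setoid)
  open BooleanAlgebraProperties booleanAlgebra public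
    using (∧-identityʳ; ∧-identityˡ; ∧-zeroʳ; ∨-identityˡ; ∨-identityʳ; ∧-idem)
  open SetoidReasoning setoid

  ¬⊥≈⊤ : ¬ ⊥ ≈ ⊤
  ¬⊥≈⊤ = begin
    ¬ ⊥      ≈⟨ ∨-identityˡ (¬ ⊥) ⟨
    ⊥ ∨ ¬ ⊥  ≈⟨ excluded-middle ⊥ ⟩
    ⊤        ∎

  [a∧¬a]∧∘a≈⊥ : ∀ a → (a ∧ ¬ a) ∧ ∘ a ≈ ⊥
  [a∧¬a]∧∘a≈⊥ a = trans (∧-assoc a (¬ a) (∘ a)) (gentle-explosion a)

  disjoint-∧ˡ : ∀ {x z} y → x ∧ z ≈ ⊥ → x ∧ (y ∧ z) ≈ ⊥
  disjoint-∧ˡ {x} {z} y x∧z≈⊥ = begin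
    x ∧ (y ∧ z)  ≈⟨ ∧-congˡ (∧-comm y z) ⟩
    x ∧ (z ∧ y)  ≈⟨ ∧-assoc x z y ⟨
    (x ∧ z) ∧ y  ≈⟨ ∧-congʳ x∧z≈⊥ ⟩
    ⊥ ∧ y        ≈⟨ ∧-comm ⊥ y ⟩
    y ∧ ⊥        ≈⟨ ∧-zeroʳ y ⟩
    ⊥            ∎

  disjoint-∧ʳ : ∀ {x y} z → x ∧ y ≈ ⊥ → x ∧ (y ∧ z) ≈ ⊥
  disjoint-∧ʳ {x} {y} z x∧y≈⊥ =
    trans (∧-congˡ (∧-comm y z)) (disjoint-∧ˡ z x∧y≈⊥)

  disjoint-cover⇒≈⊥ : ∀ {x y z} → y ∨ z ≈ ⊤ → x ∧ y ≈ ⊥ → x ∧ z ≈ ⊥ → x ≈ ⊥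
  disjoint-cover⇒≈⊥ {x} {y} {z} y∨z≈⊤ x∧y≈⊥ x∧z≈⊥ = begin
    x                  ≈⟨ ∧-identityʳ x ⟨
    x ∧ ⊤              ≈⟨ ∧-congˡ y∨z≈⊤ ⟨
    x ∧ (y ∨ z)        ≈⟨ ∧-distribˡ-∨ x y z ⟩
    (x ∧ y) ∨ (x ∧ z)  ≈⟨ ∨-cong x∧y≈⊥ x∧z≈⊥ ⟩
    ⊥ ∨ ⊥              ≈⟨ ∨-identityʳ ⊥ ⟩
    ⊥                  ∎

module BI[cl,ca∨]Properties {c ℓ} (𝐁 : BALFI c ℓ) (bi : BI[cl,ca∨] 𝐁) where
  open BALFI 𝐁
  open BI[cl,ca∨] bi
  open BALFIProperties 𝐁
  open SetoidReasoning setoid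

  -- Excluded middle at `a ∧ ¬ a`, whose negation is `∘ a` by `cl`. Together with `[a∧¬a]∧∘a≈⊥` this
  -- makes `∘ a` the Boolean complement of `a ∧ ¬ a`.
  [a∧¬a]∨∘a≈⊤ : ∀ a → (a ∧ ¬ a) ∨ ∘ a ≈ ⊤
  [a∧¬a]∨∘a≈⊤ a = trans (∨-congˡ (cl a)) (excluded-middle (a ∧ ¬ a))

  ∘[a∧¬a]≈⊤ : ∀ a → ∘ (a ∧ ¬ a) ≈ ⊤
  ∘[a∧¬a]≈⊤ a = begin
    ∘ (a ∧ ¬ a)                    ≈⟨ cl (a ∧ ¬ a) ⟩
    -- The inner `¬ (a ∧ ¬ a)` is `∘ a`, so gentle explosion at `a` itself collapses the meet.
    ¬ ((a ∧ ¬ a) ∧ ¬ (a ∧ ¬ a))    ≈⟨ ¬-cong (∧-congˡ (cl a)) ⟨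
    ¬ ((a ∧ ¬ a) ∧ ∘ a)            ≈⟨ ¬-cong ([a∧¬a]∧∘a≈⊥ a) ⟩
    ¬ ⊥                            ≈⟨ ¬⊥≈⊤ ⟩
    ⊤                              ∎

  [a∧¬a]∨[a∧∘a]≈a : ∀ a → (a ∧ ¬ a) ∨ (a ∧ ∘ a) ≈ a
  [a∧¬a]∨[a∧∘a]≈a a = begin
    (a ∧ ¬ a) ∨ (a ∧ ∘ a)        ≈⟨ ∨-congʳ (∧-congʳ (∧-idem a)) ⟨
    ((a ∧ a) ∧ ¬ a) ∨ (a ∧ ∘ a)  ≈⟨ ∨-congʳ (∧-assoc a a (¬ a)) ⟩
    (a ∧ (a ∧ ¬ a)) ∨ (a ∧ ∘ a)  ≈⟨ ∧-distribˡ-∨ a (a ∧ ¬ a) (∘ a) ⟨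
    a ∧ ((a ∧ ¬ a) ∨ ∘ a)        ≈⟨ ∧-congˡ ([a∧¬a]∨∘a≈⊤ a) ⟩
    a ∧ ⊤                        ≈⟨ ∧-identityʳ a ⟩
    a                            ∎

  -- `ca∨` is applied to the splitting of `a` into `a ∧ ¬ a` and `a ∧ ∘ a`. As `∘ (a ∧ ¬ a)` is `⊤`,
  -- it drops out of both sides, which leaves `∘ (a ∧ ∘ a)` below `∘ a`.
  ∘[a∧∘a]∧∘a≈∘[a∧∘a] : ∀ a → ∘ (a ∧ ∘ a) ∧ ∘ a ≈ ∘ (a ∧ ∘ a)
  ∘[a∧∘a]∧∘a≈∘[a∧∘a] a = begin
    ∘ y ∧ ∘ a                  ≈⟨ ∧-cong ∘x∧∘y≈∘y (∘-cong ([a∧¬a]∨[a∧∘a]≈a a)) ⟨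
    (∘ x ∧ ∘ y) ∧ ∘ (x ∨ y)    ≈⟨ ca∨ x y ⟩
    ∘ x ∧ ∘ y                  ≈⟨ ∘x∧∘y≈∘y ⟩
    ∘ y                        ∎
    where
    x y : Carrier
    x = a ∧ ¬ a
    y = a ∧ ∘ a

    ∘x∧∘y≈∘y : ∘ x ∧ ∘ y ≈ ∘ y
    ∘x∧∘y≈∘y = trans (∧-congʳ (∘[a∧¬a]≈⊤ a)) (∧-identityˡ (∘ y))

theorem3p12 : ∀ {c ℓ} (𝐀 : BALFI c ℓ) → BI[cl,ca∨] 𝐀 →
    let open BALFI 𝐀 in ∀ a → a ∧ ¬ a ≈ ⊥
-- The cover is `y ∧ ¬ y` and `∘ y`, taken at `y` rather than `a`: both parts then lie below `∘ a`,
-- which is disjoint from `a ∧ ¬ a`.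
theorem3p12 𝐀 bi a = disjoint-cover⇒≈⊥ ([a∧¬a]∨∘a≈⊤ y)
  (disjoint-∧ʳ (¬ y) (disjoint-∧ˡ a ([a∧¬a]∧∘a≈⊥ a)))
  -- Expanding `∘ y` to `∘ y ∧ ∘ a` exposes the factor `∘ a`.
  (trans (∧-congˡ (sym (∘[a∧∘a]∧∘a≈∘[a∧∘a] a)))
         (disjoint-∧ˡ (∘ y) ([a∧¬a]∧∘a≈⊥ a)))
  where
  open BALFI 𝐀
  open BALFIProperties 𝐀
  open BI[cl,ca∨]Properties 𝐀 bi

  y : Carrier
  y = a ∧ ∘ a
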